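{- A finite graph $G$ is a PR-core if and only if it is an R-cocore.
   Context: Graphs are finite and undirected, loops allowed. For a finite set $B$ and a relation $R\subseteq V_G\times B$ with full image (every $b\in B$ has some $v$ with $(v,b)\in R$), $G\ast R$ is the graph with vertex set $B$ and edge set $\{(a,b)\in B\times B: \exists (u,v)\in E_G,\ (u,a)\in R,\ (v,b)\in R\}$. Write $G\leq^{PR}H$ if there is a relation $R\subseteq V_G\times V_H$ (not necessarily with full domain) with $G\ast R=H$. This is a quasi-order; $G$ is a PR-core if it has the minimum number of vertices among all graphs $H$ with $G\leq^{PR}H\leq^{PR}G$. For an induced subgraph $H$ of $G$, an R-coretraction of $H$ to $G$ is a relation $R\subseteq V_H\times V_G$ with $H\ast R=G$ and $(x,x)\in R$ for all $x\in V_H$; in this case $H$ is called an R-coretract of $G$. $G$ is an R-cocore if no proper induced subgraph of $G$ is an R-coretract of $G$. -}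

module Defs where

open import Level using (0ℓ)
open import Data.Nat.Base using (_≤_)
open import Data.Fin.Base using (Fin)
open import Data.Fin.Subset using (Subset; _∈_; _⊂_; ⊤)
open import Data.Product.Base using (∃; ∃-syntax; _×_; proj₁)
open import Function.Base using (_on_)
open import Relation.Binary.Core using (REL; Rel; _⇔_)
open import Relation.Binary.Definitions using (Symmetric; Decidable)
open import Relation.Nullary using (¬_)

-- Edges are decidable because an edge set is a subset of a finite set;
-- loops are allowed, so irreflexivity is not required.
record Graph (V : Set) : Set₁ where
  field
    Edge      : Rel V 0ℓ
    edge?     : Decidable Edge
    symmetric : Symmetric Edge

open Graph public

FullImage : {A B : Set} → REL A B 0ℓ → Set
FullImage R = ∀ b → ∃[ a ] R a b

infixl 7 _∗_

-- The edge relation of G ∗ R.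
_∗_ : {A B : Set} → Graph A → REL A B 0ℓ → Rel B 0ℓ
(G ∗ R) a b = ∃[ u ] ∃[ v ] (Edge G u v × R u a × R v b)

infix 4 _∗_≗_ _≤ᴾᴿ_

-- G ∗ R is only formed for R with full image, so that is part of G ∗ R = H.
-- R need not have full domain.
record _∗_≗_ {A B : Set} (G : Graph A) (R : REL A B 0ℓ) (H : Graph B) : Set where
  field
    decidable : Decidable R
    fullImage : FullImage R
    edges     : (G ∗ R) ⇔ Edge H

_≤ᴾᴿ_ : {A B : Set} → Graph A → Graph B → Set₁
_≤ᴾᴿ_ {A} {B} G H = ∃[ R ] (G ∗ R ≗ H)

-- Since ≤ᴾᴿ is reflexive, G is itself among the graphs H compared here.
IsPRCore : ∀ {n} → Graph (Fin n) → Set₁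
IsPRCore {n} G = ∀ {m} (H : Graph (Fin m)) → G ≤ᴾᴿ H → H ≤ᴾᴿ G → n ≤ m

Vertices : ∀ {n} → Subset n → Set
Vertices S = ∃ (_∈ S)

induced : ∀ {n} → Graph (Fin n) → (S : Subset n) → Graph (Vertices S)
induced G S = record
  { Edge      = Edge G on proj₁
  ; edge?     = λ x y → edge? G (proj₁ x) (proj₁ y)
  ; symmetric = symmetric G
  }

IsRCoretraction : ∀ {n} (G : Graph (Fin n)) (S : Subset n) →
                  REL (Vertices S) (Fin n) 0ℓ → Set
IsRCoretraction G S R = (induced G S ∗ R ≗ G) × (∀ x → R x (proj₁ x))

IsRCoretract : ∀ {n} → Graph (Fin n) → Subset n → Set₁
IsRCoretract G S = ∃[ R ] IsRCoretraction G S R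

IsRCocore : ∀ {n} → Graph (Fin n) → Set₁
IsRCocore G = ∀ S → S ⊂ ⊤ → ¬ IsRCoretract G S

{-# OPTIONS --safe #-}
-- If G is not an R-cocore, it has a coretract avoiding some vertex x, and then
-- G with x deleted is PR-equivalent to G.
--
-- Conversely let G be an R-cocore, G ∗ R = H and H ∗ R′ = G with H on m vertices.
-- Some positive power E of R ; R′ is idempotent, since there are finitely many
-- relations on a finite set, and G ∗ E = G.  By idempotence and finiteness, every
-- pair a E b factors as a E s E b through some s with s E s, so E restricts to a
-- coretraction of the subgraph induced by the E-reflexive vertices.  As G is an
-- R-cocore, E is reflexive.  Now E factors through the vertices of H; if m < n, two
-- vertices a ≠ b share a middle vertex of a E a and b E b, hence a E b and b E a,
-- and E restricts to a coretraction of G with a deleted, a contradiction.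
module Submission where

open import Defs
open import Data.Fin.Base using (Fin)
open import Function.Bundles using (_⇔_)

open import Level using (0ℓ)
open import Data.Nat.Base using (ℕ; zero; suc; _+_; _*_; _≤_; _<′_; <′-base; <′-step)
import Data.Nat.Base as ℕ
import Data.Fin.Base as Fin
open import Data.Nat.Properties
  using (1+n≰n; ≮⇒≥; n<1+n; m≤m*n; <⇒<′; +-comm; +-assoc; +-suc; m≤n⇒∃[o]m+o≡n)
open import Data.Fin.Base using (zero; suc; toℕ; punchIn; punchOut; funToFin; finToFun)
open import Data.Fin.Properties
  using (_≟_; any?; pigeonhole; <⇒≢; finToFun-funToFin; punchIn-punchOut)
open import Data.Fin.Subset using (Subset; _∈_; ⊤; _-_)
open import Data.Fin.Subset.Properties
  using (_∈?_; ∈⊤; ⊆⊤; x∈p⇒p-x⊂p; x∈p∧x≢y⇒x∈p-y)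
open import Data.Vec.Base using (tabulate)
open import Data.Vec.Properties using ([]=⇒lookup; lookup⇒[]=; lookup∘tabulate)
open import Data.Vec.Properties.WithK using ([]=-irrelevant)
open import Data.Product.Base using (∃₂; ∃-syntax; _×_; _,_; proj₁; proj₂)
open import Function.Base using (_∘_)
open import Function.Bundles using (mk⇔)
open import Relation.Binary.Construct.Composition using (_;_)
open import Relation.Binary.Core
  using (REL; Rel; _⇒_) renaming (_⇔_ to _⇔ᴿ_)
open import Relation.Binary.Definitions
  using (Decidable; Reflexive; Transitive)
open import Relation.Unary using (Pred)
import Relation.Unary as Unary
open import Relation.Nullary using (¬_; Dec; yes; no; contradiction)
open import Relation.Nullary.Decidable using (does; map′; dec-true; _×-dec_)
open import Relation.Binary.PropositionalEquality
  using (_≡_; _≢_; refl; sym; trans; cong; subst; subst₂)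

;-decidable : ∀ {m} {A B : Set} {R : REL A (Fin m) 0ℓ} {T : REL (Fin m) B 0ℓ} →
              Decidable R → Decidable T → Decidable (R ; T)
;-decidable R? T? a b = any? λ c → R? a c ×-dec T? c b

module _ {n} {P : Pred (Fin n) 0ℓ} (P? : Unary.Decidable P) where

  comprehension : Subset n
  comprehension = tabulate (does ∘ P?)

  ∈-comprehension⁺ : ∀ {x} → P x → x ∈ comprehension
  ∈-comprehension⁺ {x} Px =
    lookup⇒[]= x _ (trans (lookup∘tabulate _ x) (dec-true (P? x) Px))

  ∈-comprehension⁻ : ∀ {x} → x ∈ comprehension → P x
  ∈-comprehension⁻ {x} x∈ with P? x | trans (sym (lookup∘tabulate (does ∘ P?) x)) ([]=⇒lookup x∈)
  ... | yes Px | _ = Px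

-- Powers of a relation and their periodicity

module _ {A : Set} where

  infix 10 _^_

  _^_ : Rel A 0ℓ → ℕ → Rel A 0ℓ
  P ^ zero  = _≡_
  P ^ suc k = P ; P ^ k

  module _ {P : Rel A 0ℓ} where

    ^-+⁺ : ∀ j {k} → P ^ j ; P ^ k ⇒ P ^ (j + k)
    ^-+⁺ zero    (_ , refl , q)          = q
    ^-+⁺ (suc j) (c , (d , p , ps) , qs) = d , p , ^-+⁺ j (c , ps , qs)

    ^-+⁻ : ∀ j {k} → P ^ (j + k) ⇒ P ^ j ; P ^ k
    ^-+⁻ zero    q            = _ , refl , q
    ^-+⁻ (suc j) (d , p , ps) with ^-+⁻ j ps
    ... | c , qs , rs = c , (d , p , qs) , rs

    ^-shift : ∀ {i j} k → P ^ i ⇒ P ^ j → P ^ (k + i) ⇒ P ^ (k + j)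
    ^-shift zero    f q            = f q
    ^-shift (suc k) f (c , p , ps) = c , p , ^-shift k f ps

  -- Write `s = i + r`. Composing the given equality with `P ^ (q * d + r)` adds one more `d` to the
  -- exponent, so induction on `q` applies.
  ^-periodic : ∀ {P : Rel A 0ℓ} {i d} → P ^ i ⇔ᴿ P ^ (i + d) →
               ∀ q {s} → i ≤ s → P ^ s ⇔ᴿ P ^ (s + q * d)
  ^-periodic {P} {i} {d} (f , g) q i≤s with m≤n⇒∃[o]m+o≡n i≤s
  ... | r , refl = to q , from q
    where
    Pow : ℕ → Rel A 0ℓ
    Pow = P ^_

    move : ∀ q → q * d + r + i ≡ i + r + q * d
    move q = trans (+-comm (q * d + r) i)
               (trans (cong (i +_) (+-comm (q * d) r)) (sym (+-assoc i r (q * d))))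

    move′ : ∀ q → q * d + r + (i + d) ≡ i + r + suc q * d
    move′ q = trans (sym (+-assoc (q * d + r) i d))
                (trans (cong (_+ d) (move q))
                  (trans (+-assoc (i + r) (q * d) d)
                    (cong (i + r +_) (+-comm (q * d) d))))

    step : ∀ q → Pow (i + r + q * d) ⇔ᴿ Pow (i + r + suc q * d)
    step q = (λ {x} {y} → subst₂ (λ j k → Pow j x y → Pow k x y) (move q) (move′ q)
                            (^-shift (q * d + r) f))
           , (λ {x} {y} → subst₂ (λ j k → Pow k x y → Pow j x y) (move q) (move′ q)
                            (^-shift (q * d + r) g))

    +0 : i + r ≡ i + r + 0 * d
    +0 = +-comm 0 (i + r)

    to : ∀ q → Pow (i + r) ⇒ Pow (i + r + q * d)
    to zero    {x} {y} = subst (λ k → Pow k x y) +0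
    to (suc q)         = proj₁ (step q) ∘ to q

    from : ∀ q → Pow (i + r + q * d) ⇒ Pow (i + r)
    from zero    {x} {y} = subst (λ k → Pow k x y) (sym +0)
    from (suc q)         = from q ∘ proj₂ (step q)

^-decidable : ∀ {n} {P : Rel (Fin n) 0ℓ} → Decidable P → ∀ k → Decidable (P ^ k)
^-decidable P? zero    = _≟_
^-decidable P? (suc k) = ;-decidable P? (^-decidable P? k)

-- Coding relations by numbers, and idempotent powers

bit : {A : Set} → Dec A → Fin 2
bit (yes _) = suc zero
bit (no  _) = zero

bit≡⇒ : {A B : Set} (a? : Dec A) (b? : Dec B) → bit a? ≡ bit b? → A → B
bit≡⇒ _        (yes b) _  _ = b
bit≡⇒ (yes _)  (no _)  () _
bit≡⇒ (no ¬a)  (no _)  _  a = contradiction a ¬a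

-- The truth table as a number below a bound that depends only on `n`, so that the pigeonhole
-- principle applies to the powers of a relation.
encode : ∀ {n} {P : Rel (Fin n) 0ℓ} → Decidable P → Fin ((2 ℕ.^ n) ℕ.^ n)
encode P? = funToFin λ a → funToFin λ b → bit (P? a b)

encode≡⇒ : ∀ {n} {P Q : Rel (Fin n) 0ℓ} (P? : Decidable P) (Q? : Decidable Q) →
           encode P? ≡ encode Q? → P ⇒ Q
encode≡⇒ P? Q? eq {a} {b} = bit≡⇒ (P? a b) (Q? a b)
  (trans (sym (decode P?)) (trans (cong (λ k → finToFun (finToFun k a) b) eq) (decode Q?)))
  where
  decode : ∀ {P} (P? : Decidable P) → finToFun (finToFun (encode P?) a) b ≡ bit (P? a b)
  decode P? = trans (cong (λ k → finToFun k b) (finToFun-funToFin _ a))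
                    (finToFun-funToFin _ b)

-- If P ^ i = P ^ (i + d) with i and d positive, then P ^ (i * d) is idempotent.
∃-idempotent-power : ∀ {n} {P : Rel (Fin n) 0ℓ} → Decidable P →
                     ∃[ k ] P ^ suc k ⇔ᴿ (P ^ suc k ; P ^ suc k)
∃-idempotent-power {P = P} P?
  -- One more power is listed than there are codes, so two coincide; the successor keeps their
  -- exponents positive.
  with pigeonhole (n<1+n _) (λ i → encode (^-decidable P? (suc (toℕ i))))
... | i , j , i<j , eq with m≤n⇒∃[o]m+o≡n i<j
-- The successor of this witness computes to `s`.
...   | d , i+d≡j = d + toℕ i * d′ , (λ {x} {y} → ^-+⁻ s ∘ proj₁ double {x} {y})
                      , (λ {x} {y} → proj₂ double {x} {y} ∘ ^-+⁺ s)
  where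
  i′ = suc (toℕ i)
  d′ = suc d
  s  = i′ * d′
  j′≡i′+d′ : suc (toℕ j) ≡ i′ + d′
  j′≡i′+d′ = cong suc (trans (sym i+d≡j) (sym (+-suc (toℕ i) d)))
  j? = ^-decidable P? (suc (toℕ j))
  i? = ^-decidable P? i′
  double : P ^ s ⇔ᴿ P ^ (s + s)
  double = ^-periodic
    (subst (λ k → P ^ i′ ⇔ᴿ P ^ k) j′≡i′+d′
      (encode≡⇒ i? j? eq , encode≡⇒ j? i? (sym eq)))
    -- Going `i′` periods further adds `i′ * d′`, which is `s` itself; `s` is past the threshold
    -- `i′` because `d′` is positive.
    i′ (m≤m*n i′ d′)

module _ {n} {E : Rel (Fin n) 0ℓ} (E-trans : Transitive E) (dense : E ⇒ E ; E) where

  -- Repeated interpolation yields an E-ascending sequence between a and b; a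
  -- repeated entry of that sequence is E-related to itself.
  reflexive-interpolant : ∀ {a b} → E a b → ∃[ s ] (E s s × E a s × E s b)
  reflexive-interpolant {a} {b} aEb = repeat (pigeonhole (n<1+n n) (c ∘ toℕ))
    where
    chain : ℕ → ∃[ c ] (E a c × E c b)
    chain zero    = dense aEb
    chain (suc k) = let _ , aEc , cEb = chain k
                        d , cEd , dEb = dense cEb
                    in d , E-trans aEc cEd , dEb

    c : ℕ → Fin n
    c = proj₁ ∘ chain

    ascending : ∀ {i j} → i <′ j → E (c i) (c j)
    ascending {i} <′-base = proj₁ (proj₂ (dense (proj₂ (proj₂ (chain i)))))
    ascending {j = suc j} (<′-step i<j) = E-trans (ascending i<j) (ascending {j} <′-base)

    repeat : ∃₂ (λ i j → i Fin.< j × c (toℕ i) ≡ c (toℕ j)) →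
             ∃[ s ] (E s s × E a s × E s b)
    repeat (i , j , i<j , eq) =
      let s , aEs , sEb = chain (toℕ i)
      in s , subst (E s) (sym eq) (ascending (<⇒<′ i<j)) , aEs , sEb

-- Identity, composites and powers acting on graphs

∗-≡ : ∀ {A : Set} {G : Graph A} → Decidable {A = A} _≡_ → G ∗ _≡_ ≗ G
∗-≡ _≟_ = record
  { decidable = _≟_
  ; fullImage = λ b → b , refl
  ; edges     = (λ { (_ , _ , e , refl , refl) → e }) , λ e → _ , _ , e , refl , refl
  }

module _ {m} {A B : Set} {G : Graph A} {H : Graph (Fin m)} {K : Graph B} where

  ∗-; : ∀ {R T} → G ∗ R ≗ H → H ∗ T ≗ K → G ∗ (R ; T) ≗ K
  ∗-; r t = record
    { decidable = ;-decidable R.decidable T.decidable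
    ; fullImage = λ b → let c , cTb = T.fullImage b ; a , aRc = R.fullImage c
                        in a , c , aRc , cTb
    ; edges     =
        (λ { (u , v , e , (a , uRa , aTx) , (b , vRb , bTy)) →
             proj₁ T.edges (a , b , proj₁ R.edges (u , v , e , uRa , vRb) , aTx , bTy) })
      , λ e → let a , b , e′ , aTx , bTy = proj₂ T.edges e
                  u , v , e″ , uRa , vRb = proj₂ R.edges e′
              in u , v , e″ , (a , uRa , aTx) , (b , vRb , bTy)
    }
    where
    module R = _∗_≗_ r
    module T = _∗_≗_ t

∗-^ : ∀ {n} {G : Graph (Fin n)} {P} → G ∗ P ≗ G → ∀ k → G ∗ (P ^ k) ≗ G
∗-^ p zero    = ∗-≡ _≟_
∗-^ p (suc k) = ∗-; p (∗-^ p k)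

-- Coretractions cut out of a relation that fixes the graph

module _ {n} {G : Graph (Fin n)} {E : Rel (Fin n) 0ℓ} (G∗E≗G : G ∗ E ≗ G) where

  open _∗_≗_ G∗E≗G

  -- If an edge `(u , v)` yields `(a , b)` and the two pairs factor through `s` and `t` in `S`, then
  -- `(s , t)` is an edge of `G ∗ E`, hence of `G`, and it yields `(a , b)` from within `S`.
  restricted-coretraction :
    (S : Subset n) → (∀ {x} → x ∈ S → E x x) →
    (∀ {a b} → E a b → ∃[ s ] (s ∈ S × E a s × E s b)) → IsRCoretract G S
  restricted-coretraction S E-refl factor = (λ x → E (proj₁ x)) , record
    { decidable = λ x → decidable (proj₁ x)
    ; fullImage = λ b → let s , s∈S , _ , sEb = factor (proj₂ (fullImage b))
                        in (s , s∈S) , sEb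
    ; edges     =
        (λ { (u , v , e , uEa , vEb) → proj₁ edges (_ , _ , e , uEa , vEb) })
      , λ e → let u , v , e′ , uEa , vEb = proj₂ edges e
                  s , s∈S , uEs , sEa = factor uEa
                  t , t∈S , vEt , tEb = factor vEb
              in (s , s∈S) , (t , t∈S) , proj₁ edges (u , v , e′ , uEs , vEt) , sEa , tEb
    } , E-refl ∘ proj₂

  module _ (cocore : IsRCocore G) (E-trans : Transitive E) where

    cocore⇒reflexive : E ⇒ E ; E → Reflexive E
    cocore⇒reflexive dense {x} with x ∈? S
      where
      S : Subset n
      S = comprehension λ x → decidable x x
    ... | yes x∈S = ∈-comprehension⁻ (λ x → decidable x x) x∈S
    ... | no  x∉S = contradiction
      (restricted-coretraction _ (∈-comprehension⁻ λ x → decidable x x) λ aEb →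
        let s , sEs , aEs , sEb = reflexive-interpolant E-trans dense aEb
        in s , ∈-comprehension⁺ (λ x → decidable x x) sEs , aEs , sEb)
      (cocore _ (⊆⊤ , x , ∈⊤ , x∉S))

    -- Otherwise `b` could stand in for `a` as a middle vertex, and every pair would factor through
    -- a vertex other than `a`.
    cocore⇒antisymmetric : Reflexive E → ∀ {a b} → E a b → E b a → a ≡ b
    cocore⇒antisymmetric E-refl {a} {b} aEb bEa with a ≟ b
    ... | yes a≡b = a≡b
    ... | no  a≢b = contradiction
      (restricted-coretraction (⊤ - a) (λ _ → E-refl) factor)
      (cocore (⊤ - a) (x∈p⇒p-x⊂p ∈⊤))
      where
      factor : ∀ {x y} → E x y → ∃[ s ] (s ∈ ⊤ - a × E x s × E s y)
      factor {x} {y} xEy with y ≟ a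
      ... | yes refl = b , x∈p∧x≢y⇒x∈p-y ∈⊤ (a≢b ∘ sym) , E-trans xEy aEb , bEa
      ... | no  y≢a  = y , x∈p∧x≢y⇒x∈p-y ∈⊤ y≢a , xEy , E-refl

-- From R-cocore to PR-core

cocore⇒core : ∀ {n} {G : Graph (Fin n)} → IsRCocore G → IsPRCore G
cocore⇒core {n} {G} cocore {m} H (R , G∗R≗H) (R′ , H∗R′≗G)
  with ∃-idempotent-power (_∗_≗_.decidable (∗-; G∗R≗H H∗R′≗G))
... | k , dense , merge = ≮⇒≥ λ m<n →
  let _ , _ , a<b , eq = pigeonhole m<n (proj₁ ∘ middle)
  in <⇒≢ a<b (cocore⇒antisymmetric G∗E≗G cocore
       (λ {x} {y} {z} → E-trans {x} {y} {z}) (λ {x} → E-refl {x}) (via eq) (via (sym eq)))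
  where
  E = (R ; R′) ^ suc k

  G∗E≗G : G ∗ E ≗ G
  G∗E≗G = ∗-^ (∗-; G∗R≗H H∗R′≗G) (suc k)

  E-trans : Transitive E
  E-trans xEy yEz = merge (_ , xEy , yEz)

  E-refl : Reflexive E
  E-refl = cocore⇒reflexive G∗E≗G cocore (λ {x} {y} {z} → E-trans {x} {y} {z}) dense

  -- The exponent is positive, so a path witnessing `E a a` begins with an `R`-step into `H`.
  middle : ∀ a → ∃[ c ] (R a c × (R′ ; (R ; R′) ^ k) c a)
  middle a = let d , (c , aRc , cR′d) , dPa = E-refl {a} in c , aRc , d , cR′d , dPa

  -- Enter the common middle vertex from `a`, then follow the path of `b` onwards.
  via : ∀ {a b} → proj₁ (middle a) ≡ proj₁ (middle b) → E a b
  via {a} {b} eq = let _ , aRc , _            = middle a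
                       _ , _ , d , cR′d , dPb = middle b
                   in d , (_ , subst (R a) eq aRc , cR′d) , dPb

-- From PR-core to R-cocore, by deleting a vertex

delete : ∀ {n} → Graph (Fin (suc n)) → Fin (suc n) → Graph (Fin n)
delete G x = record
  { Edge      = λ i j → Edge G (punchIn x i) (punchIn x j)
  ; edge?     = λ i j → edge? G (punchIn x i) (punchIn x j)
  ; symmetric = symmetric G
  }

≤ᴾᴿ-delete : ∀ {n} (G : Graph (Fin (suc n))) x → G ≤ᴾᴿ delete G x
≤ᴾᴿ-delete G x = (λ a i → a ≡ punchIn x i) , record
  { decidable = λ a i → a ≟ punchIn x i
  ; fullImage = λ i → punchIn x i , refl
  ; edges     = (λ { (_ , _ , e , refl , refl) → e }) , λ e → _ , _ , e , refl , refl
  }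

-- Since `S` misses `x`, it embeds in the remaining vertices, and `R` is carried along. Remaining
-- vertices outside `S` are related to nothing.
delete-≤ᴾᴿ : ∀ {n} (G : Graph (Fin (suc n))) {x S} →
             ¬ x ∈ S → IsRCoretract G S → delete G x ≤ᴾᴿ G
delete-≤ᴾᴿ {n} G {x} {S} x∉S (R , G∗R≗G , _) = R′ , record
  { decidable = R′?
  ; fullImage = λ b → let a , aRb = fullImage b in index a , index-R′ a aRb
  ; edges     =
      (λ { (_ , _ , e , (u∈S , uRa) , (v∈S , vRb)) → proj₁ edges (_ , _ , e , uRa , vRb) })
    , λ e → let u , v , e′ , uRa , vRb = proj₂ edges e
            in index u , index v
             , subst₂ (Edge G) (sym (punchIn-index u)) (sym (punchIn-index v)) e′
             , index-R′ u uRa , index-R′ v vRb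
  }
  where
  open _∗_≗_ G∗R≗G

  R′ : REL (Fin n) (Fin (suc n)) 0ℓ
  R′ i b = ∃[ i∈S ] R (punchIn x i , i∈S) b

  R′? : Decidable R′
  R′? i b with punchIn x i ∈? S
  ... | yes i∈S = map′ (i∈S ,_)
                       -- `R` takes a membership proof as part of its argument; such proofs are
                       -- unique, so deciding for one of them decides for all.
                       (λ (i∈S′ , r) → subst (λ i∈S → R (_ , i∈S) b) ([]=-irrelevant i∈S′ i∈S) r)
                       (decidable (_ , i∈S) b)
  ... | no  i∉S = no (i∉S ∘ proj₁)

  x≢ : (a : Vertices S) → x ≢ proj₁ a
  x≢ (_ , a∈S) refl = x∉S a∈S

  index : Vertices S → Fin n
  index a = punchOut (x≢ a)

  punchIn-index : ∀ a → punchIn x (index a) ≡ proj₁ a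
  punchIn-index a = punchIn-punchOut (x≢ a)

  index-R′ : ∀ a {b} → R a b → R′ (index a) b
  index-R′ a@(_ , a∈S) {b} aRb =
    subst (λ c → ∃[ c∈S ] R (c , c∈S) b) (sym (punchIn-index a)) (a∈S , aRb)

core⇒cocore : ∀ {n} {G : Graph (Fin n)} → IsPRCore G → IsRCocore G
core⇒cocore {zero}      core S (_ , () , _)
core⇒cocore {suc n} {G} core S (_ , x , _ , x∉S) retract =
  1+n≰n (core (delete G x) (≤ᴾᴿ-delete G x) (delete-≤ᴾᴿ G x∉S retract))

theorem5p9p3 : ∀ {n} (G : Graph (Fin n)) → IsPRCore G ⇔ IsRCocore G
theorem5p9p3 G = mk⇔ core⇒cocore cocore⇒core
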